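{- For each nonnegative integer $k$, the maps $\mathrm{swu}:\mathcal U_{2k+1}(231)\to\mathcal U_{2k+1}(132)$ and $\mathrm{swd}:\mathcal U_{2k+1}(132)\to\mathcal U_{2k+1}(231)$ are well defined bijections that are inverses of each other.
   Context: Permutations are finite words of distinct positive integers; $S_n$ is the set of permutations of $[n]$. The stack-sorting map $s$: $s(\text{empty})=\text{empty}$, and if $\pi=LnR$ with $n$ the largest entry, $s(\pi)=s(L)s(R)n$. A permutation is uniquely sorted if it has exactly one preimage under $s$. A permutation avoids $\tau$ if no subsequence has the same relative order as $\tau$; $\mathcal U_n(\tau)$ is the set of uniquely sorted permutations in $S_n$ avoiding $\tau$. $\mathrm{rev}$ reverses a word. Sliding operators: for $\pi\in S_n$ and $i\in[n]$, let $L_i$ (resp. $R_i$) be the set of elements of $[i-1]$ lying to the left (resp. right) of the entry $i$ in $\pi$. Define $\mathrm{swu}_i(\pi)$ entrywise: if $\pi_j\ge i$ its $j$-th entry is $\pi_j$; if $\pi_j$ is the $m$-th smallest element of $R_i$ its $j$-th entry is $m$; if $\pi_j$ is the $m$-th largest element of $L_i$ its $j$-th entry is $i-m$. Let $\mathrm{swd}_i(\pi)=\mathrm{rev}(\mathrm{swu}_i(\mathrm{rev}(\pi)))$. Define $\mathrm{swu}=\mathrm{swu}_1\circ\mathrm{swu}_2\circ\cdots\circ\mathrm{swu}_n$ and $\mathrm{swd}=\mathrm{swd}_1\circ\cdots\circ\mathrm{swd}_n$ on $S_n$. -}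

module Defs where

open import Data.Nat using (ℕ; zero; suc; _+_; _*_; _∸_; _≤_; _<_; _⊔_; _≟_; _≤?_; _<?_)
open import Data.List using (List; []; _∷_; _++_; [_]; map; length; filter; span; drop; reverse; upTo; foldr)
open import Data.List.Relation.Binary.Permutation.Propositional using (_↭_)
open import Data.List.Relation.Binary.Sublist.Propositional using (_⊆_)
open import Data.List.Relation.Binary.Pointwise using (Pointwise)
open import Data.Product using (Σ; _×_; ∃)
open import Data.Unit using (⊤)
open import Data.Empty using (⊥)
open import Function.Bundles using (_⇔_)
open import Relation.Nullary using (¬_; does)
open import Relation.Nullary.Decidable using (¬?; _×-dec_)
open import Relation.Binary.PropositionalEquality using (_≡_)
open import Data.Bool using (if_then_else_)

IsPerm : ℕ → List ℕ → Set
IsPerm n π = π ↭ map suc (upTo n)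

-- Stack-sorting map  s(LmR) = s(L) s(R) m  (m = largest entry).
-- Implemented with fuel (the length of the word), which always suffices.
maxL : List ℕ → ℕ
maxL = foldr _⊔_ 0

stackSortF : ℕ → List ℕ → List ℕ
stackSortF zero    _        = []
stackSortF (suc f) []       = []
stackSortF (suc f) (x ∷ xs) =
  let m   = maxL (x ∷ xs)
      sp  = span (λ y → ¬? (y ≟ m)) (x ∷ xs)
      L   = Data.Product.proj₁ sp
      R   = drop 1 (Data.Product.proj₂ sp)
  in stackSortF f L ++ stackSortF f R ++ [ m ]

s : List ℕ → List ℕ
s π = stackSortF (length π) π

UniquelySorted : ℕ → List ℕ → Set
UniquelySorted n π =
  Σ (List ℕ) λ σ → IsPerm n σ × s σ ≡ π × (∀ τ → IsPerm n τ → s τ ≡ π → τ ≡ σ)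

OrderIso : List ℕ → List ℕ → Set
OrderIso []       []       = ⊤
OrderIso []       (_ ∷ _)  = ⊥
OrderIso (_ ∷ _)  []       = ⊥
OrderIso (x ∷ xs) (y ∷ ys) =
  Pointwise (λ a b → ((x < a) ⇔ (y < b)) × ((a < x) ⇔ (b < y))) xs ys × OrderIso xs ys

Contains : List ℕ → List ℕ → Set
Contains π τ = ∃ λ σ → σ ⊆ π × OrderIso σ τ

Avoids : List ℕ → List ℕ → Set
Avoids π τ = ¬ Contains π τ

U : ℕ → List ℕ → List ℕ → Set
U n τ π = IsPerm n π × UniquelySorted n π × Avoids π τ

p231 p132 : List ℕ
p231 = 2 ∷ 3 ∷ 1 ∷ []
p132 = 1 ∷ 3 ∷ 2 ∷ []

count : {P : ℕ → Set} → (∀ y → Relation.Nullary.Dec (P y)) → List ℕ → ℕ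
count P? xs = length (filter P? xs)

-- swu_i.  Write π = A ++ (i ∷ B); A holds L_i ∪ (larger entries), B holds R_i ∪ (larger).
-- Entry x < i to the right of i (x = m-th smallest of R_i) becomes m;
-- entry x < i to the left of i (x = m-th largest of L_i) becomes i - m;
-- entries ≥ i are unchanged.
swuAt : ℕ → List ℕ → List ℕ
swuAt i π =
  let sp   = span (λ y → ¬? (y ≟ i)) π
      A    = Data.Product.proj₁ sp
      rest = Data.Product.proj₂ sp
      left  = λ x → if does (i ≤? x) then x
                    else i ∸ count (λ y → (x ≤? y) ×-dec (y <? i)) A
      right = λ x → if does (i ≤? x) then x
                    else count (λ y → (y ≤? x) ×-dec (y <? i)) rest
  in map left A ++ map right rest

swdAt : ℕ → List ℕ → List ℕ
swdAt i π = reverse (swuAt i (reverse π))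

swu : ℕ → List ℕ → List ℕ
swu zero    π = π
swu (suc m) π = swu m (swuAt (suc m) π)

swd : ℕ → List ℕ → List ℕ
swd zero    π = π
swd (suc m) π = swd m (swdAt (suc m) π)

{-# OPTIONS --safe #-}
-- A preimage of π under s is a decreasing binary tree with postorder reading π: every node must be the
-- maximum of the factor of π formed by its subtree. Which position carries the maximum of a factor depends
-- only on the shape of the decreasing binary tree with inorder reading π, and swu_i preserves that shape:
-- two entries smaller than i change their relative order only if i stands between them, and then any factor
-- containing both has its maximum at an unchanged entry ≥ i. So swu and swd preserve unique sortedness on all
-- permutations. The image of swu avoids 132, since after swu_i no 132 pattern has its "3" played by an entry
-- ≥ i, and symmetrically that of swd avoids 231. A shape carries exactly one 132-avoiding and exactly one
-- 231-avoiding permutation, so on the two classes the maps are mutually inverse.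
module Submission where

open import Defs
open import Data.Bool using (if_then_else_)
open import Data.Empty using (⊥; ⊥-elim)
open import Data.List using (List; []; _∷_; _++_; [_]; map; length; filter; span; drop; reverse; upTo)
open import Data.List.Membership.Propositional using (_∈_; _∉_)
open import Data.List.Membership.Propositional.Properties using
  (∈-∃++; ∈-++⁺ˡ; ∈-++⁺ʳ; ∈-++⁻; ∈-map⁺; ∈-map⁻; ∈-upTo⁺; ∈-upTo⁻; ∈-insert; ∈-filter⁻)
open import Data.List.Properties using
  (length-++; length-map; length-upTo; ++-assoc; ++-identityʳ; map-++; map-∘; map-id; map-cong-local;
   ∷-injective; reverse-++; reverse-involutive; reverse-injective; unfold-reverse)
open import Data.List.Relation.Binary.Permutation.Propositional using (_↭_; ↭-refl; ↭-sym; ↭-trans; prep; ↭⇒↭ₛ)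
import Data.List.Relation.Binary.Permutation.Propositional.Properties as Perm
import Data.List.Relation.Binary.Permutation.Setoid.Properties as SetoidPerm
open import Data.List.Relation.Binary.Pointwise using ([]; _∷_)
open import Data.List.Relation.Binary.Sublist.Propositional using
  (_⊆_; []; _∷_; _∷ʳ_; ⊆-refl; ⊆-trans; minimum; from∈) renaming (lookup to ⊆⇒∈)
import Data.List.Relation.Binary.Sublist.Propositional.Properties as Sub
open import Data.List.Relation.Unary.All using (All; []; _∷_; lookup; tabulate; zip) renaming (map to All-map)
open import Data.List.Relation.Unary.All.Properties using (++⁺; ++⁻ˡ; ++⁻ʳ)
import Data.List.Relation.Unary.All.Properties as All
open import Data.List.Relation.Unary.AllPairs using ([]; _∷_)
open import Data.List.Relation.Unary.Any using (here; there)
open import Data.List.Relation.Unary.Unique.Propositional using (Unique)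
import Data.List.Relation.Unary.Unique.Propositional.Properties as Unique
open import Data.Nat using (ℕ; zero; suc; _+_; _*_; _∸_; _≤_; _<_; s≤s; z≤n; _≟_; _≤?_; _<?_)
open import Data.Nat.Properties hiding (_≟_; _≤?_; _<?_)
open import Data.Product using (_×_; _,_; proj₁; proj₂; ∃; ∃₂)
open import Data.Sum using (_⊎_; inj₁; inj₂)
open import Data.Unit using (tt)
open import Function.Base using (_∘_; id)
open import Function.Bundles using (_⇔_; mk⇔; Equivalence)
open import Relation.Binary.Definitions using (tri<; tri≈; tri>)
open import Relation.Binary.PropositionalEquality hiding ([_])
open import Relation.Nullary using (¬_; Dec; yes; no; does)
open import Relation.Nullary.Decidable using (¬?; _×-dec_; dec-true; dec-false)

private variable
  n : ℕ
  xs ys zs : List ℕ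

-- Lists and permutations of [n]

Unique-⊆ : xs ⊆ ys → Unique ys → Unique xs
Unique-⊆ []       []       = []
Unique-⊆ (y ∷ʳ p) (_ ∷ u)  = Unique-⊆ p u
Unique-⊆ (refl ∷ p) (x≢ ∷ u) = Sub.All-resp-⊆ p x≢ ∷ Unique-⊆ p u

Unique-++-≢ : ∀ {x y} xs → Unique (xs ++ ys) → x ∈ xs → y ∈ ys → x ≢ y
Unique-++-≢ (_ ∷ xs) (x≢ ∷ _) (here refl) y∈ = lookup x≢ (∈-++⁺ʳ xs y∈)
Unique-++-≢ (_ ∷ xs) (_ ∷ u)  (there x∈)  y∈ = Unique-++-≢ xs u x∈ y∈

Unique-map : (f : ℕ → ℕ) → (∀ {x y} → x ∈ xs → y ∈ xs → x ≢ y → f x ≢ f y) → Unique xs → Unique (map f xs)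
Unique-map f inj []       = []
Unique-map f inj (x≢ ∷ u) =
  All.map⁺ (tabulate λ y∈ → inj (here refl) (there y∈) (lookup x≢ y∈)) ∷
  Unique-map f (λ p q → inj (there p) (there q)) u

Unique-resp-↭ : xs ↭ ys → Unique xs → Unique ys
Unique-resp-↭ p = SetoidPerm.Unique-resp-↭ (setoid ℕ) (↭⇒↭ₛ p)

Unique-∷⇒∉ : ∀ {x} → Unique (x ∷ xs) → x ∉ xs
Unique-∷⇒∉ (x≢ ∷ _) x∈ = lookup x≢ x∈ refl

Unique⇒↭++ : Unique xs → (∀ {x} → x ∈ xs → x ∈ ys) → ∃ λ zs → ys ↭ xs ++ zs
Unique⇒↭++ {ys = ys} [] _ = ys , ↭-refl
Unique⇒↭++ {x ∷ xs} u@(_ ∷ u′) sub with ∈-∃++ (sub (here refl))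
... | as , bs , refl with Unique⇒↭++ {ys = as ++ bs} u′ drop-x
  where
  drop-x : ∀ {y} → y ∈ xs → y ∈ as ++ bs
  drop-x y∈ with ∈-++⁻ as (sub (there y∈))
  ... | inj₁ p         = ∈-++⁺ˡ p
  ... | inj₂ (here refl) = ⊥-elim (Unique-∷⇒∉ u y∈)
  ... | inj₂ (there p) = ∈-++⁺ʳ as p
... | zs , p = zs , ↭-trans (Perm.shift x as bs) (prep x p)

-- The source of every numerical bound below: it keeps the counts of `swuAt` in range and later pins
-- the labels of a 132-avoiding word.
pigeonhole : ∀ a b → Unique xs → All (λ x → a ≤ x × x < b) xs → length xs ≤ b ∸ a
pigeonhole {xs} a b u bnd with Unique⇒↭++ {ys = map (a +_) (upTo (b ∸ a))} u into
  where
  into : ∀ {x} → x ∈ xs → x ∈ map (a +_) (upTo (b ∸ a))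
  into x∈ with a≤x , x<b ← lookup bnd x∈ =
    subst (_∈ _) (m+[n∸m]≡n a≤x) (∈-map⁺ (a +_) (∈-upTo⁺ (∸-monoˡ-< x<b a≤x)))
... | zs , p = begin
  length xs                          ≤⟨ m≤m+n _ _ ⟩
  length xs + length zs              ≡⟨ length-++ xs ⟨
  length (xs ++ zs)                  ≡⟨ Perm.↭-length p ⟨
  length (map (a +_) (upTo (b ∸ a))) ≡⟨ trans (length-map _ (upTo (b ∸ a))) (length-upTo _) ⟩
  b ∸ a                              ∎
  where open ≤-Reasoning

InRange : ℕ → ℕ → Set
InRange n x = 1 ≤ x × x < suc n

IsPerm⇒Unique : IsPerm n xs → Unique xs
IsPerm⇒Unique {n} p = Unique-resp-↭ (↭-sym p) (Unique.map⁺ suc-injective (Unique.upTo⁺ n))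

IsPerm⇒∈ : IsPerm n xs → ∀ {i} → i < n → suc i ∈ xs
IsPerm⇒∈ p i<n = Perm.∈-resp-↭ (↭-sym p) (∈-map⁺ suc (∈-upTo⁺ i<n))

IsPerm⇒InRange : IsPerm n xs → All (InRange n) xs
IsPerm⇒InRange {n} p = Perm.All-resp-↭ (↭-sym p) (tabulate go)
  where
  go : ∀ {x} → x ∈ map suc (upTo n) → InRange n x
  go x∈ with ∈-map⁻ suc x∈
  ... | _ , y∈ , refl = s≤s z≤n , s≤s (∈-upTo⁻ y∈)

IsPerm⇒length : IsPerm n xs → length xs ≡ n
IsPerm⇒length {n} p = trans (Perm.↭-length p) (trans (length-map suc (upTo n)) (length-upTo n))

toIsPerm : Unique xs → All (InRange n) xs → length xs ≡ n → IsPerm n xs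
toIsPerm {xs} {n} u bnd len with Unique⇒↭++ {ys = map suc (upTo n)} u into
  where
  into : ∀ {x} → x ∈ xs → x ∈ map suc (upTo n)
  into {zero}  x∈ with () , _ ← lookup bnd x∈
  into {suc x} x∈ = ∈-map⁺ suc (∈-upTo⁺ (≤-pred (proj₂ (lookup bnd x∈))))
... | [] , p = ↭-sym (subst (_ ↭_) (++-identityʳ xs) p)
... | z ∷ zs , p = ⊥-elim (m≢1+m+n (length xs) (begin
  length xs                  ≡⟨ len ⟩
  n                          ≡⟨ trans (length-map suc (upTo n)) (length-upTo n) ⟨
  length (map suc (upTo n))  ≡⟨ trans (Perm.↭-length p) (length-++ xs) ⟩
  length xs + length (z ∷ zs) ≡⟨ +-suc (length xs) (length zs) ⟩
  suc (length xs + length zs) ∎))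
  where open ≡-Reasoning

++-≡-split : ∀ (as {bs} cs {ds} : List ℕ) → as ++ bs ≡ cs ++ ds →
  (∃ λ es → as ≡ cs ++ es × ds ≡ es ++ bs) ⊎ (∃ λ es → cs ≡ as ++ es × bs ≡ es ++ ds)
++-≡-split as       []       refl = inj₁ (as , refl , refl)
++-≡-split []       cs       refl = inj₂ (cs , refl , refl)
++-≡-split (a ∷ as) (c ∷ cs) eq with refl , eq′ ← ∷-injective eq with ++-≡-split as cs eq′
... | inj₁ (es , refl , q) = inj₁ (es , refl , q)
... | inj₂ (es , refl , q) = inj₂ (es , refl , q)

++-injective-length : ∀ (as {bs} cs {ds} : List ℕ) → length as ≡ length cs → as ++ bs ≡ cs ++ ds → as ≡ cs × bs ≡ ds
++-injective-length []       []       _  eq = refl , eq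
++-injective-length (a ∷ as) (c ∷ cs) le eq with refl , eq′ ← ∷-injective eq
  with refl , q ← ++-injective-length as cs (suc-injective le) eq′ = refl , q

-- Shapes of decreasing binary trees

data Shape : Set where
  leaf : Shape
  node : Shape → Shape → Shape

size : Shape → ℕ
size leaf       = 0
size (node l r) = suc (size l + size r)

mirror : Shape → Shape
mirror leaf       = leaf
mirror (node l r) = node (mirror r) (mirror l)

mirror-involutive : ∀ t → mirror (mirror t) ≡ t
mirror-involutive leaf       = refl
mirror-involutive (node l r) = cong₂ node (mirror-involutive l) (mirror-involutive r)

infix 4 _⊩_

-- `t ⊩ xs` says that `t` is the shape of the decreasing binary tree with inorder reading `xs`. As a
-- relation, it lets two words of the same shape be taken apart in parallel.
data _⊩_ : Shape → List ℕ → Set where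
  leaf : leaf ⊩ []
  node : ∀ {l r L m R} → l ⊩ L → r ⊩ R → All (_< m) L → All (_< m) R → node l r ⊩ L ++ m ∷ R

⊩-length : ∀ {t} → t ⊩ xs → length xs ≡ size t
⊩-length leaf = refl
⊩-length (node {L = L} {m} {R} l r _ _) =
  trans (length-++ L) (trans (+-suc (length L) (length R)) (cong suc (cong₂ _+_ (⊩-length l) (⊩-length r))))

⊩-reverse : ∀ {t} → t ⊩ xs → mirror t ⊩ reverse xs
⊩-reverse leaf = leaf
⊩-reverse (node {l} {r} {L} {m} {R} tl tr pl pr) =
  subst (node (mirror r) (mirror l) ⊩_) (sym rev-eq)
    (node (⊩-reverse tr) (⊩-reverse tl) (Perm.All-resp-↭ (↭-sym (Perm.↭-reverse R)) pr) (Perm.All-resp-↭ (↭-sym (Perm.↭-reverse L)) pl))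
  where
  open ≡-Reasoning
  rev-eq : reverse (L ++ m ∷ R) ≡ reverse R ++ m ∷ reverse L
  rev-eq = begin
    reverse (L ++ m ∷ R)            ≡⟨ reverse-++ L (m ∷ R) ⟩
    reverse (m ∷ R) ++ reverse L    ≡⟨ cong (_++ reverse L) (unfold-reverse m R) ⟩
    (reverse R ++ [ m ]) ++ reverse L ≡⟨ ++-assoc (reverse R) _ _ ⟩
    reverse R ++ m ∷ reverse L      ∎

-- A new first entry goes down the left spine until it exceeds the current root; it then takes that
-- place, with the old subtree on its right.
⊩-∷ : ∀ {x t} → x ∉ xs → t ⊩ xs → ∃ λ t′ → t′ ⊩ x ∷ xs
⊩-∷ x∉ leaf = node leaf leaf , node leaf leaf [] []
⊩-∷ {x = x} {t} x∉ (node {L = L} {m} {R} tl tr pl pr) with <-cmp x m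
... | tri< x<m _ _ with _ , t′ ← ⊩-∷ (x∉ ∘ ∈-++⁺ˡ) tl = _ , node t′ tr (x<m ∷ pl) pr
... | tri≈ _ refl _ = ⊥-elim (x∉ (∈-insert L))
... | tri> _ _ m<x = _ , node leaf (node tl tr pl pr) [] (++⁺ (All-map (λ p → <-trans p m<x) pl) (m<x ∷ All-map (λ p → <-trans p m<x) pr))

Unique⇒⊩ : Unique xs → ∃ λ t → t ⊩ xs
Unique⇒⊩ []        = leaf , leaf
Unique⇒⊩ u@(_ ∷ u′) = ⊩-∷ (Unique-∷⇒∉ u) (proj₂ (Unique⇒⊩ u′))

⊩-map : ∀ {t} (f : ℕ → ℕ) → (∀ {x y} → x ∈ xs → y ∈ xs → x < y → f x < f y) → t ⊩ xs → t ⊩ map f xs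
⊩-map f mono leaf = leaf
⊩-map f mono (node {l} {r} {L} {m} {R} tl tr pl pr) =
  subst (node l r ⊩_) (sym (map-++ f L (m ∷ R)))
    (node (⊩-map f (λ p q → mono (∈-++⁺ˡ p) (∈-++⁺ˡ q)) tl)
          (⊩-map f (λ p q → mono (∈-++⁺ʳ L (there p)) (∈-++⁺ʳ L (there q))) tr)
          (All.map⁺ (tabulate λ p → mono (∈-++⁺ˡ p) (∈-insert L) (lookup pl p)))
          (All.map⁺ (tabulate λ p → mono (∈-++⁺ʳ L (there p)) (∈-insert L) (lookup pr p))))

-- Stack-sorting preimages

-- xs and map g xs have the same decreasing binary tree shape.
data SameShape (g : ℕ → ℕ) : List ℕ → Set where
  nil  : SameShape g []
  node : ∀ {L m R} → SameShape g L → SameShape g R →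
         All (λ x → x < m × g x < g m) L → All (λ x → x < m × g x < g m) R → SameShape g (L ++ m ∷ R)

-- Both left factors have length `size l`, so the two decompositions cut at the same position and
-- `g` sends root to root.
⊩⇒SameShape : ∀ {t} g → t ⊩ xs → t ⊩ ys → map g xs ≡ ys → SameShape g xs
⊩⇒SameShape g leaf leaf _ = nil
⊩⇒SameShape g (node {L = L} {m} {R} tl tr pl pr) (node {L = L′} {m′} {R′} tl′ tr′ pl′ pr′) eq
  with refl , eq′ ← ++-injective-length (map g L) L′
         (trans (length-map g L) (trans (⊩-length tl) (sym (⊩-length tl′)))) (trans (sym (map-++ g L (m ∷ R))) eq)
  with refl , refl ← ∷-injective eq′
  = node (⊩⇒SameShape g tl tl′ refl) (⊩⇒SameShape g tr tr′ refl)
         (zip (pl , All.map⁻ pl′)) (zip (pr , All.map⁻ pr′))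

-- Cutting a word cuts its tree: one piece keeps the root, and the cut continues in the subtree on
-- its side. So the comparison of shapes passes to all factors.
SameShape-++⁻ : ∀ {g} us {vs} → xs ≡ us ++ vs → SameShape g xs → SameShape g us × SameShape g vs
SameShape-++⁻ [] refl nil = nil , nil
SameShape-++⁻ us {vs} eq (node {L} {m} {R} hl hr pl pr) with ++-≡-split L us eq
... | inj₁ (es , refl , refl) with h₁ , h₂ ← SameShape-++⁻ us refl hl = h₁ , node h₂ hr (++⁻ʳ us pl) pr
... | inj₂ ([] , q , refl) = subst (SameShape _) (sym (trans q (++-identityʳ L))) hl , node nil hr [] pr
... | inj₂ (_ ∷ es , refl , refl) with h₁ , h₂ ← SameShape-++⁻ es refl hr = node hl h₁ pl (++⁻ˡ es pr) , h₂

SameShape-max : ∀ {g m} → SameShape g xs → m ∈ xs → All (_≤ m) xs → ∀ {x} → x ∈ xs → x < m → g x < g m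
SameShape-max (node {L} {M} {R} _ _ pl pr) m∈ ≤m x∈ x<m with ∈-++⁻ L m∈
... | inj₁ q = ⊥-elim (<⇒≱ (proj₁ (lookup pl q)) (lookup ≤m (∈-insert L)))
... | inj₂ (there q) = ⊥-elim (<⇒≱ (proj₁ (lookup pr q)) (lookup ≤m (∈-insert L)))
... | inj₂ (here refl) with ∈-++⁻ L x∈
...   | inj₁ q = proj₂ (lookup pl q)
...   | inj₂ (here refl) = ⊥-elim (<-irrefl refl x<m)
...   | inj₂ (there q) = proj₂ (lookup pr q)

-- The graph of the stack-sorting map

-- The graph of `s` without fuel: a derivation is a decreasing tree whose inorder reading is the
-- first word and whose postorder reading is the second.
data SortsTo : List ℕ → List ℕ → Set where
  nil  : SortsTo [] []
  node : ∀ {L m R u v} → SortsTo L u → SortsTo R v → All (_< m) L → All (_< m) R →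
         SortsTo (L ++ m ∷ R) (u ++ v ++ [ m ])

SortsTo⇒↭ : SortsTo xs ys → xs ↭ ys
SortsTo⇒↭ nil = ↭-refl
SortsTo⇒↭ (node {L} {m} {R} {u} {v} p q _ _) =
  Perm.++⁺ (SortsTo⇒↭ p) (↭-trans (prep m (SortsTo⇒↭ q)) (Perm.∷↭∷ʳ m v))

⊩⇒SortsTo : ∀ {t} → t ⊩ xs → ∃ (SortsTo xs)
⊩⇒SortsTo leaf = [] , nil
⊩⇒SortsTo (node tl tr pl pr) = _ , node (proj₂ (⊩⇒SortsTo tl)) (proj₂ (⊩⇒SortsTo tr)) pl pr

span-≢ : ∀ m L {R} → m ∉ L → span (λ y → ¬? (y ≟ m)) (L ++ m ∷ R) ≡ (L , m ∷ R)
span-≢ m [] _ rewrite dec-true (m ≟ m) refl = refl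
span-≢ m (x ∷ L) m∉ rewrite dec-false (x ≟ m) (m∉ ∘ here ∘ sym) =
  cong (λ sp → x ∷ proj₁ sp , proj₂ sp) (span-≢ m L (m∉ ∘ there))

maxL-≤ : ∀ {m} → All (_≤ m) xs → maxL xs ≤ m
maxL-≤ []       = z≤n
maxL-≤ (p ∷ ps) = ⊔-lub p (maxL-≤ ps)

maxL-node : ∀ {m} L {R} → All (_< m) L → All (_< m) R → maxL (L ++ m ∷ R) ≡ m
maxL-node []      _        pr = m≥n⇒m⊔n≡m (maxL-≤ (All-map <⇒≤ pr))
maxL-node (x ∷ L) (p ∷ pl) pr = trans (m≤n⇒m⊔n≡n (≤-trans (<⇒≤ p) (≤-reflexive (sym (maxL-node L pl pr))))) (maxL-node L pl pr)

stackSortF-node : ∀ {m} f L {R} → All (_< m) L → All (_< m) R →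
  stackSortF (suc f) (L ++ m ∷ R) ≡ stackSortF f L ++ stackSortF f R ++ [ m ]
stackSortF-node {m} f L {R} pl pr = begin
  stackSortF (suc f) (L ++ m ∷ R)             ≡⟨ unfold L ⟩
  body (maxL (L ++ m ∷ R)) (L ++ m ∷ R)       ≡⟨ cong (λ k → body k (L ++ m ∷ R)) (maxL-node L pl pr) ⟩
  body m (L ++ m ∷ R)                         ≡⟨ cong (join m) (span-≢ m L (λ m∈ → <-irrefl refl (lookup pl m∈))) ⟩
  stackSortF f L ++ stackSortF f R ++ [ m ]   ∎
  where
  open ≡-Reasoning
  join : ℕ → List ℕ × List ℕ → List ℕ
  join k (ws , ws′) = stackSortF f ws ++ stackSortF f (drop 1 ws′) ++ [ k ]
  body : ℕ → List ℕ → List ℕ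
  body k ws = join k (span (λ y → ¬? (y ≟ k)) ws)
  -- `stackSortF` computes only on a visible cons cell, and `L ++ m ∷ R` shows one only after `L` is
  -- split.
  unfold : ∀ L → stackSortF (suc f) (L ++ m ∷ R) ≡ body (maxL (L ++ m ∷ R)) (L ++ m ∷ R)
  unfold []      = refl
  unfold (_ ∷ _) = refl

stackSortF-SortsTo : ∀ f → SortsTo xs ys → length xs ≤ f → stackSortF f xs ≡ ys
stackSortF-SortsTo zero    nil _ = refl
stackSortF-SortsTo (suc f) nil _ = refl
stackSortF-SortsTo zero (node {[]} _ _ _ _) ()
stackSortF-SortsTo zero (node {_ ∷ _} _ _ _ _) ()
stackSortF-SortsTo (suc f) (node {L} {m} {R} p q pl pr) len = trans (stackSortF-node f L pl pr)
  (cong₂ (λ u v → u ++ v ++ [ m ])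
    (stackSortF-SortsTo f p (≤-trans (m≤m+n _ _) len′))
    (stackSortF-SortsTo f q (≤-trans (m≤n+m _ (length L)) len′)))
  where
  len′ : length L + length R ≤ f
  len′ = ≤-pred (subst (_≤ suc f) (trans (length-++ L) (+-suc (length L) (length R))) len)

SortsTo⇒s : SortsTo xs ys → s xs ≡ ys
SortsTo⇒s p = stackSortF-SortsTo _ p ≤-refl

Unique⇒SortsTo : Unique xs → SortsTo xs (s xs)
Unique⇒SortsTo {xs} u with _ , p ← ⊩⇒SortsTo (proj₂ (Unique⇒⊩ u)) = subst (SortsTo xs) (sym (SortsTo⇒s p)) p

-- `u`, `v` and the whole output are factors of `ys`. Since `g` keeps the position of the maximum in
-- each factor, every node of the relabelled tree is still the maximum of its subtree.
SortsTo-map : ∀ g → SortsTo xs ys → SameShape g ys → SortsTo (map g xs) (map g ys)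
SortsTo-map g nil _ = nil
SortsTo-map g (node {L} {m} {R} {u} {v} p q pl pr) h =
  subst₂ SortsTo (sym (map-++ g L (m ∷ R))) (sym (trans (map-++ g u (v ++ [ m ])) (cong (map g u ++_) (map-++ g v [ m ]))))
    (node (SortsTo-map g p hu) (SortsTo-map g q hv)
      (All.map⁺ (tabulate λ x∈ → SameShape-max h m∈ ≤m (Perm.∈-resp-↭ L++R↭ (∈-++⁺ˡ x∈)) (lookup pl x∈)))
      (All.map⁺ (tabulate λ x∈ → SameShape-max h m∈ ≤m (Perm.∈-resp-↭ L++R↭ (∈-++⁺ʳ L (there x∈))) (lookup pr x∈))))
  where
  L++R↭ : L ++ m ∷ R ↭ u ++ v ++ [ m ]
  L++R↭ = SortsTo⇒↭ (node p q pl pr)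
  m∈ : m ∈ u ++ v ++ [ m ]
  m∈ = Perm.∈-resp-↭ L++R↭ (∈-insert L)
  ≤m : All (_≤ m) (u ++ v ++ [ m ])
  ≤m = Perm.All-resp-↭ L++R↭ (++⁺ (All-map <⇒≤ pl) (≤-refl ∷ All-map <⇒≤ pr))
  hu : SameShape g u
  hu = proj₁ (SameShape-++⁻ u refl h)
  hv : SameShape g v
  hv = proj₁ (SameShape-++⁻ v refl (proj₂ (SameShape-++⁻ u refl h)))

relabelling : Unique xs → length xs ≡ length ys → ∃ λ g → map g xs ≡ ys
relabelling {ys = []} [] _ = id , refl
relabelling {x ∷ xs} {y ∷ ys} (x≢ ∷ u) len with g , eq ← relabelling {ys = ys} u (suc-injective len) =
  g′ , cong₂ _∷_ (cong (λ b → if b then y else g x) (dec-true (x ≟ x) refl))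
    (trans (map-cong-local (All-map (λ {z} x≢z → cong (λ b → if b then y else g z) (dec-false (z ≟ x) (x≢z ∘ sym))) x≢)) eq)
  where
  g′ : ℕ → ℕ
  g′ z = if does (z ≟ x) then y else g z

map-≡⇒fix : ∀ (f : ℕ → ℕ) → map f xs ≡ xs → All (λ x → f x ≡ x) xs
map-≡⇒fix {[]}     f _  = []
map-≡⇒fix {x ∷ xs} f eq with p , q ← ∷-injective eq = p ∷ map-≡⇒fix f q

-- Relabelling by `g` carries preimages of `xs` to preimages of `ys`, and `h` carries them back. A
-- preimage `τ` of `ys` thus gives `map h τ`, which must be `σ`.
UniquelySorted-⊩ : ∀ {t} → IsPerm n xs → IsPerm n ys → t ⊩ xs → t ⊩ ys → UniquelySorted n xs → UniquelySorted n ys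
UniquelySorted-⊩ {n} {xs} {ys} px py tx ty (σ , pσ , refl , uniq)
  with g , refl ← relabelling {ys = ys} (IsPerm⇒Unique px) (trans (IsPerm⇒length px) (sym (IsPerm⇒length py)))
  with h , hg ← relabelling {ys = xs} (IsPerm⇒Unique py) (trans (IsPerm⇒length py) (sym (IsPerm⇒length px)))
  = map g σ , ↭-trans (SortsTo⇒↭ σ⇒) py , SortsTo⇒s σ⇒ , uniq′
  where
  σ⇒ : SortsTo (map g σ) (map g (s σ))
  σ⇒ = SortsTo-map g (Unique⇒SortsTo (IsPerm⇒Unique pσ)) (⊩⇒SameShape g tx ty refl)
  uniq′ : ∀ τ → IsPerm n τ → s τ ≡ map g (s σ) → τ ≡ map g σ
  uniq′ τ pτ sτ = begin
    τ                 ≡⟨ map-id τ ⟨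
    -- `g ∘ h` is known to be the identity only on entries of the output; those are also the entries
    -- of `τ`, as sorting permutes.
    map id τ          ≡⟨ map-cong-local (All-map sym (Perm.All-resp-↭ (↭-sym τ↭) gh-fix)) ⟩
    map (g ∘ h) τ     ≡⟨ map-∘ τ ⟩
    map g (map h τ)   ≡⟨ cong (map g) (uniq (map h τ) (↭-trans (SortsTo⇒↭ hτ⇒) px) (SortsTo⇒s hτ⇒)) ⟩
    map g σ           ∎
    where
    open ≡-Reasoning
    τ⇒ : SortsTo τ (map g (s σ))
    τ⇒ = subst (SortsTo τ) sτ (Unique⇒SortsTo (IsPerm⇒Unique pτ))
    τ↭ : τ ↭ map g (s σ)
    τ↭ = SortsTo⇒↭ τ⇒
    hτ⇒ : SortsTo (map h τ) (s σ)
    hτ⇒ = subst (SortsTo (map h τ)) hg (SortsTo-map h τ⇒ (⊩⇒SameShape h ty tx hg))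
    gh-fix : All (λ y → g (h y) ≡ y) (map g (s σ))
    gh-fix = map-≡⇒fix (g ∘ h) (trans (map-∘ (map g (s σ))) (cong (map g) hg))

-- The sliding operators

-- The effect of swu_i on the entries X on one side of i.
record Squeeze (i : ℕ) (X : List ℕ) (f : ℕ → ℕ) : Set where
  field
    fixed    : ∀ {x} → i ≤ x → f x ≡ x
    low      : ∀ {x} → x ∈ X → x < i → f x < i
    positive : ∀ {x} → x ∈ X → x < i → 1 ≤ f x
    mono-low : ∀ {x y} → x ∈ X → y ∈ X → x < y → y < i → f x < f y

  -- Values from `i` upwards act as a barrier: they stay put and small entries stay below `i`, so a
  -- comparison with such a `v` survives the slide in both directions.
  below : ∀ {x v} → x ∈ X → i ≤ v → x < v → f x < v
  below {x} x∈ i≤v x<v with i ≤? x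
  ... | yes i≤x = subst (_< _) (sym (fixed i≤x)) x<v
  ... | no i≰x  = <-≤-trans (low x∈ (≰⇒> i≰x)) i≤v

  below⁻ : ∀ {x v} → i ≤ v → f x < v → x < v
  below⁻ {x} i≤v fx<v with i ≤? x
  ... | yes i≤x = subst (_< _) (fixed i≤x) fx<v
  ... | no i≰x  = <-≤-trans (≰⇒> i≰x) i≤v

  high⁻ : ∀ {x} → x ∈ X → i ≤ f x → i ≤ x
  high⁻ {x} x∈ i≤fx with i ≤? x
  ... | yes i≤x = i≤x
  ... | no i≰x  = ⊥-elim (<⇒≱ (low x∈ (≰⇒> i≰x)) i≤fx)

  mono : ∀ {x y} → x ∈ X → y ∈ X → x < y → f x < f y
  mono {x} {y} x∈ y∈ x<y with i ≤? y
  ... | yes i≤y = subst (f x <_) (sym (fixed i≤y)) (below x∈ i≤y x<y)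
  ... | no i≰y  = mono-low x∈ y∈ x<y (≰⇒> i≰y)

  injective : ∀ {x y} → x ∈ X → y ∈ X → x ≢ y → f x ≢ f y
  injective {x} {y} x∈ y∈ x≢y with <-cmp x y
  ... | tri< x<y _ _ = <⇒≢ (mono x∈ y∈ x<y)
  ... | tri≈ _ x≡y _ = ⊥-elim (x≢y x≡y)
  ... | tri> _ _ y<x = <⇒≢ (mono y∈ x∈ y<x) ∘ sym

  restrict : ∀ {Y} → (∀ {x} → x ∈ Y → x ∈ X) → Squeeze i Y f
  restrict sub .fixed = fixed
  restrict sub .low = low ∘ sub
  restrict sub .positive = positive ∘ sub
  restrict sub .mono-low p q = mono-low (sub p) (sub q)

-- The end of the recursion: `i` is itself the root, so each subtree lies on one side of it and is
-- relabelled monotonically.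
⊩-slide-root : ∀ {i f g l r A B} → Squeeze i A f → Squeeze i (i ∷ B) g → l ⊩ A → r ⊩ B →
  All (_< i) A → All (_< i) B → node l r ⊩ map f A ++ map g (i ∷ B)
⊩-slide-root {f = f} {g} sf sg tl tr pl pr =
  node (⊩-map f (mono sf) tl)
       (⊩-map g (λ p q → mono sg (there p) (there q)) tr)
       (All.map⁺ (tabulate λ p → subst (f _ <_) (sym (fixed sg ≤-refl)) (low sf p (lookup pl p))))
       (All.map⁺ (tabulate λ p → mono sg (there p) (here refl) (lookup pr p)))
  where open Squeeze

-- Descent to the node `i`. At a larger root `m` the value is fixed, the subtree without `i` lies on
-- one side of `i` and is relabelled monotonically, and the subtree with `i` is handled recursively.
⊩-slide : ∀ {i f g t} A B → xs ≡ A ++ i ∷ B → Squeeze i A f → Squeeze i (i ∷ B) g →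
  t ⊩ xs → t ⊩ map f A ++ map g (i ∷ B)
⊩-slide [] B () sf sg leaf
⊩-slide (_ ∷ _) B () sf sg leaf
⊩-slide {i = i} {f} {g} {t} A B eq sf sg (node {l} {r} {L} {m} {R} tl tr pl pr) with ++-≡-split L A eq
-- The root is to the left of `i`, which lies in the right subtree.
... | inj₂ (m ∷ es , refl , refl) =
  subst (t ⊩_) (sym (trans (cong (_++ map g (i ∷ B)) (map-++ f L (m ∷ es))) (++-assoc (map f L) _ _)))
    (node (⊩-map f (λ p q → mono (∈-++⁺ˡ p) (∈-++⁺ˡ q)) tl)
          (⊩-slide es B refl (Squeeze.restrict sf (∈-++⁺ʳ L ∘ there)) sg tr)
          (All.map⁺ (tabulate λ p → mono (∈-++⁺ˡ p) (∈-insert L) (lookup pl p)))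
          (++⁺ (All.map⁺ (tabulate λ p → mono (∈-++⁺ʳ L (there p)) (∈-insert L) (lookup (++⁻ˡ es pr) p)))
               (All.map⁺ (tabulate λ p → subst (g _ <_) (sym (fixed i≤m)) (Squeeze.below sg p i≤m (lookup (++⁻ʳ es pr) p))))))
  where
  open Squeeze sf
  i≤m : i ≤ m
  i≤m = <⇒≤ (lookup pr (∈-insert es))
-- The root is to the right of `i`, which lies in the left subtree.
... | inj₁ (i ∷ es , refl , refl) =
  subst (t ⊩_) (trans (++-assoc (map f A) _ _) (cong (map f A ++_) (sym (map-++ g (i ∷ es) (m ∷ R)))))
    (node (⊩-slide A es refl sf (Squeeze.restrict sg (∈-++⁺ˡ {xs = i ∷ es})) tl)
          (⊩-map g (λ p q → mono (∈-++⁺ʳ (i ∷ es) (there p)) (∈-++⁺ʳ (i ∷ es) (there q))) tr)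
          (++⁺ (All.map⁺ (tabulate λ p → subst (f _ <_) (sym (fixed i≤m)) (Squeeze.below sf p i≤m (lookup (++⁻ˡ A pl) p))))
               (All.map⁺ (tabulate λ p → mono (∈-++⁺ˡ p) (∈-insert (i ∷ es)) (lookup (++⁻ʳ A pl) p))))
          (All.map⁺ (tabulate λ p → mono (∈-++⁺ʳ (i ∷ es) (there p)) (∈-insert (i ∷ es)) (lookup pr p))))
  where
  open Squeeze sg
  i≤m : i ≤ m
  i≤m = <⇒≤ (lookup pl (∈-insert A))
-- An empty remainder means that the root is `i`; the type of the split allows this in either
-- summand.
... | inj₂ ([] , A≡ , refl) with refl ← trans (sym (++-identityʳ L)) (sym A≡) =
  ⊩-slide-root sf sg tl tr pl pr
... | inj₁ ([] , L≡ , refl) with refl ← trans (sym (++-identityʳ A)) (sym L≡) =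
  ⊩-slide-root sf sg tl tr pl pr

-- After the slide, small entries left of `i` exceed small entries right of it. This destroys the
-- 132 patterns with `i` as the "3" and keeps the two sides disjoint.
Cross : ℕ → List ℕ → List ℕ → (ℕ → ℕ) → (ℕ → ℕ) → Set
Cross i A B f g = ∀ {a b} → a ∈ A → b ∈ B → a < i → b < i → g b < f a

Unique-slide : ∀ {i f g} A {B} → Squeeze i A f → Squeeze i B g → Cross i A B f g →
  Unique (A ++ B) → Unique (map f A ++ map g B)
Unique-slide {i} {f} {g} A {B} sf sg cross u = Unique.++⁺
  (Unique-map f (injective sf) (Unique-⊆ (Sub.++⁺ʳ B ⊆-refl) u))
  (Unique-map g (injective sg) (Unique-⊆ (Sub.++⁺ˡ A ⊆-refl) u))
  (λ (p , q) → disjoint p q)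
  where
  open Squeeze
  apart : ∀ {a b} → a ∈ A → b ∈ B → f a ≢ g b
  apart {a} {b} a∈ b∈ eq with i ≤? a | i ≤? b
  ... | yes i≤a | yes i≤b = Unique-++-≢ A u a∈ b∈ (trans (sym (fixed sf i≤a)) (trans eq (fixed sg i≤b)))
  ... | yes i≤a | no i≰b  = <⇒≱ (low sg b∈ (≰⇒> i≰b)) (subst (i ≤_) (trans (sym (fixed sf i≤a)) eq) i≤a)
  ... | no i≰a  | yes i≤b = <⇒≱ (low sf a∈ (≰⇒> i≰a)) (subst (i ≤_) (trans (sym (fixed sg i≤b)) (sym eq)) i≤b)
  ... | no i≰a  | no i≰b  = <⇒≢ (cross a∈ b∈ (≰⇒> i≰a) (≰⇒> i≰b)) (sym eq)
  disjoint : ∀ {v} → v ∈ map f A → v ∉ map g B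
  disjoint p q with ∈-map⁻ f p | ∈-map⁻ g q
  ... | _ , a∈ , refl | _ , b∈ , eq = apart a∈ b∈ eq

InRange-squeeze : ∀ {i f} → i ≤ n → Squeeze i xs f → All (InRange n) xs → All (InRange n) (map f xs)
InRange-squeeze {n} {xs} {i} {f} i≤n sf rng = All.map⁺ (tabulate go)
  where
  open Squeeze sf
  go : ∀ {x} → x ∈ xs → InRange n (f x)
  go {x} x∈ with i ≤? x
  ... | yes i≤x = subst (InRange n) (sym (fixed i≤x)) (lookup rng x∈)
  ... | no i≰x  = positive x∈ (≰⇒> i≰x) , <-trans (low x∈ (≰⇒> i≰x)) (s≤s i≤n)

-- No 132 pattern in which an entry ≥ k plays the "3"; from k = 1 on this is avoidance of 132, since v > a
-- already forces v ≥ 1. The conclusion b < a absorbs the distinctness of the entries.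
Avoids132From : ℕ → List ℕ → Set
Avoids132From k xs = ∀ {a v b} → a ∷ v ∷ b ∷ [] ⊆ xs → k ≤ v → a < v → b < v → b < a

⊆-map⁻ : ∀ (f : ℕ → ℕ) ys → xs ⊆ map f ys → ∃ λ us → us ⊆ ys × xs ≡ map f us
⊆-map⁻ f []       []         = [] , [] , refl
⊆-map⁻ f (y ∷ ys) (_ ∷ʳ p)   with us , q , eq ← ⊆-map⁻ f ys p = us , y ∷ʳ q , eq
⊆-map⁻ f (y ∷ ys) (refl ∷ p) with us , q , eq ← ⊆-map⁻ f ys p = y ∷ us , refl ∷ q , cong (f y ∷_) eq

⊆-++⁻ : ∀ ys → xs ⊆ ys ++ zs → ∃₂ λ us vs → us ⊆ ys × vs ⊆ zs × xs ≡ us ++ vs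
⊆-++⁻ []       p          = [] , _ , [] , p , refl
⊆-++⁻ (y ∷ ys) (_ ∷ʳ p)   with us , vs , q , r , eq ← ⊆-++⁻ ys p = us , vs , y ∷ʳ q , r , eq
⊆-++⁻ (y ∷ ys) (refl ∷ p) with us , vs , q , r , eq ← ⊆-++⁻ ys p = y ∷ us , vs , refl ∷ q , r , cong (y ∷_) eq

⊆-map-++-map⁻ : ∀ (f g : ℕ → ℕ) ys → xs ⊆ map f ys ++ map g zs →
  ∃₂ λ us vs → us ⊆ ys × vs ⊆ zs × xs ≡ map f us ++ map g vs
⊆-map-++-map⁻ f g ys p with us′ , vs′ , q , r , refl ← ⊆-++⁻ (map f ys) p
  with us , q′ , refl ← ⊆-map⁻ f ys q with vs , r′ , refl ← ⊆-map⁻ g _ r = us , vs , q′ , r′ , refl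

-- If the "3" exceeds `i`, it is fixed and the triple pulls back to one with the same "3", where
-- `avoid` applies; the resulting order is pushed forward again. If the "3" is `i`, the outer
-- entries lie on opposite sides and `cross` orders them.
Avoids132From-slide : ∀ {i f g} A {B} → Unique (A ++ i ∷ B) → Squeeze i A f → Squeeze i (i ∷ B) g →
  Cross i A (i ∷ B) f g → Avoids132From (suc i) (A ++ i ∷ B) → Avoids132From i (map f A ++ map g (i ∷ B))
Avoids132From-slide {i} {f} {g} A {B} u sf sg cross avoid p = go (⊆-map-++-map⁻ f g A p)
  where
  open Squeeze
  i∉A : i ∉ A
  i∉A i∈ = Unique-++-≢ A u i∈ (here refl) refl
  i∉B : i ∉ B
  i∉B = Unique-∷⇒∉ (Unique-⊆ (Sub.++⁺ˡ A ⊆-refl) u)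
  cross-mono : ∀ {a b} → a ∈ A → b ∈ i ∷ B → b < a → g b < f a
  cross-mono {a} a∈ b∈ b<a with i ≤? a
  ... | yes i≤a = subst (g _ <_) (sym (fixed sf i≤a)) (below sg b∈ i≤a b<a)
  ... | no i≰a  = cross a∈ b∈ (≰⇒> i≰a) (<-trans b<a (≰⇒> i≰a))
  -- The cases record how many of the three entries lie in `A`. Only with exactly one there can the
  -- middle entry be `i`.
  go : ∀ {a v b} → (∃₂ λ us vs → us ⊆ A × vs ⊆ i ∷ B × a ∷ v ∷ b ∷ [] ≡ map f us ++ map g vs) →
       i ≤ v → a < v → b < v → b < a
  go ([] , a ∷ v ∷ b ∷ [] , _ , q , refl) i≤gv ga<gv gb<gv
    with i≤v ← high⁻ sg (⊆⇒∈ q (there (here refl))) i≤gv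
    with a<v ← below⁻ sg i≤v (subst (g a <_) (fixed sg i≤v) ga<gv)
    with b<v ← below⁻ sg i≤v (subst (g b <_) (fixed sg i≤v) gb<gv)
    with m≤n⇒m<n∨m≡n i≤v
  ... | inj₁ i<v = mono sg (⊆⇒∈ q (there (there (here refl)))) (⊆⇒∈ q (here refl)) (avoid (Sub.++⁺ˡ A q) i<v a<v b<v)
  ... | inj₂ refl with q
  ...   | _ ∷ʳ q′  = ⊥-elim (i∉B (⊆⇒∈ q′ (there (here refl))))
  ...   | refl ∷ q′ = ⊥-elim (i∉B (⊆⇒∈ q′ (here refl)))
  go (a ∷ [] , v ∷ b ∷ [] , p , q , refl) i≤gv fa<gv gb<gv
    with i≤v ← high⁻ sg (⊆⇒∈ q (here refl)) i≤gv
    with a<v ← below⁻ sf i≤v (subst (f a <_) (fixed sg i≤v) fa<gv)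
    with b<v ← below⁻ sg i≤v (subst (g b <_) (fixed sg i≤v) gb<gv)
    with m≤n⇒m<n∨m≡n i≤v
  ... | inj₁ i<v  = cross-mono (⊆⇒∈ p (here refl)) (⊆⇒∈ q (there (here refl))) (avoid (Sub.++⁺ p q) i<v a<v b<v)
  ... | inj₂ refl = cross (⊆⇒∈ p (here refl)) (⊆⇒∈ q (there (here refl))) a<v b<v
  go (a ∷ v ∷ [] , b ∷ [] , p , q , refl) i≤fv fa<fv gb<fv
    with i≤v ← high⁻ sf (⊆⇒∈ p (there (here refl))) i≤fv
    with a<v ← below⁻ sf i≤v (subst (f a <_) (fixed sf i≤v) fa<fv)
    with b<v ← below⁻ sg i≤v (subst (g b <_) (fixed sf i≤v) gb<fv)
    with m≤n⇒m<n∨m≡n i≤v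
  ... | inj₁ i<v  = cross-mono (⊆⇒∈ p (here refl)) (⊆⇒∈ q (here refl)) (avoid (Sub.++⁺ p q) i<v a<v b<v)
  ... | inj₂ refl = ⊥-elim (i∉A (⊆⇒∈ p (there (here refl))))
  go (a ∷ v ∷ b ∷ [] , [] , p , _ , refl) i≤fv fa<fv fb<fv
    with i≤v ← high⁻ sf (⊆⇒∈ p (there (here refl))) i≤fv
    with a<v ← below⁻ sf i≤v (subst (f a <_) (fixed sf i≤v) fa<fv)
    with b<v ← below⁻ sf i≤v (subst (f b <_) (fixed sf i≤v) fb<fv)
    with m≤n⇒m<n∨m≡n i≤v
  ... | inj₁ i<v  = mono sf (⊆⇒∈ p (there (there (here refl)))) (⊆⇒∈ p (here refl)) (avoid (Sub.++⁺ʳ (i ∷ B) p) i<v a<v b<v)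
  ... | inj₂ refl = ⊥-elim (i∉A (⊆⇒∈ p (there (here refl))))

-- Counting windows and the bounds for one slide

count-∈ : ∀ {P : ℕ → Set} (P? : ∀ y → Dec (P y)) {x} → x ∈ xs → P x → 0 < count P? xs
count-∈ P? {x} (here refl) Px rewrite dec-true (P? x) Px = s≤s z≤n
count-∈ {xs = y ∷ _} P? (there x∈) Px with P? y
... | yes _ = s≤s z≤n
... | no _  = count-∈ P? x∈ Px

count-≤ : ∀ {P Q : ℕ → Set} (P? : ∀ y → Dec (P y)) (Q? : ∀ y → Dec (Q y)) → (∀ {y} → P y → Q y) →
  ∀ xs → count P? xs ≤ count Q? xs
count-≤ P? Q? P⇒Q []       = z≤n
count-≤ P? Q? P⇒Q (y ∷ xs) with P? y | Q? y
... | yes _  | yes _  = s≤s (count-≤ P? Q? P⇒Q xs)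
... | yes Py | no ¬Qy = ⊥-elim (¬Qy (P⇒Q Py))
... | no _   | yes _  = m≤n⇒m≤1+n (count-≤ P? Q? P⇒Q xs)
... | no _   | no _   = count-≤ P? Q? P⇒Q xs

count-< : ∀ {P Q : ℕ → Set} (P? : ∀ y → Dec (P y)) (Q? : ∀ y → Dec (Q y)) → (∀ {y} → P y → Q y) →
  ∀ {x} → x ∈ xs → Q x → ¬ P x → count P? xs < count Q? xs
count-< {_ ∷ xs} P? Q? P⇒Q {x} (here refl) Qx ¬Px rewrite dec-false (P? x) ¬Px | dec-true (Q? x) Qx =
  s≤s (count-≤ P? Q? P⇒Q xs)
count-< {y ∷ xs} P? Q? P⇒Q (there x∈) Qx ¬Px with P? y | Q? y
... | yes _  | yes _  = s≤s (count-< P? Q? P⇒Q x∈ Qx ¬Px)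
... | yes Py | no ¬Qy = ⊥-elim (¬Qy (P⇒Q Py))
... | no _   | yes _  = m≤n⇒m≤1+n (count-< P? Q? P⇒Q x∈ Qx ¬Px)
... | no _   | no _   = count-< P? Q? P⇒Q x∈ Qx ¬Px

-- The predicates counted in `swuAt`: for a small `x` among distinct entries left of `i`, the count
-- is its rank from the top in `L_i`; `inWindowʳ` similarly gives the rank from the bottom in `R_i`.
inWindowˡ : ∀ i x y → Dec (x ≤ y × y < i)
inWindowˡ i x y = (x ≤? y) ×-dec (y <? i)

inWindowʳ : ∀ i x y → Dec (y ≤ x × y < i)
inWindowʳ i x y = (y ≤? x) ×-dec (y <? i)

slideˡ slideʳ : ℕ → List ℕ → ℕ → ℕ
slideˡ i A x = if does (i ≤? x) then x else i ∸ count (inWindowˡ i x) A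
slideʳ i B x = if does (i ≤? x) then x else count (inWindowʳ i x) B

-- The right block includes `i`, since `span` stops before it. This is harmless: `slideʳ` fixes `i`,
-- and the window condition `y < i` never counts it.
swuAt-++ : ∀ i A {B} → i ∉ A → swuAt i (A ++ i ∷ B) ≡ map (slideˡ i A) A ++ map (slideʳ i (i ∷ B)) (i ∷ B)
swuAt-++ i A {B} i∉ = cong (λ sp → map (slideˡ i (proj₁ sp)) (proj₁ sp) ++ map (slideʳ i (proj₂ sp)) (proj₂ sp)) (span-≢ i A i∉)

module _ {j : ℕ} (A B : List ℕ) (u : Unique (A ++ B)) (pos : All (1 ≤_) (A ++ B)) where
  private
    i : ℕ
    i = suc j

    countˡ countʳ : ℕ → ℕ
    countˡ x = count (inWindowˡ i x) A
    countʳ x = count (inWindowʳ i x) B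

  slideˡ-high : ∀ {x} → i ≤ x → slideˡ i A x ≡ x
  slideˡ-high {x} i≤x rewrite dec-true (i ≤? x) i≤x = refl

  slideˡ-low : ∀ {x} → x < i → slideˡ i A x ≡ i ∸ countˡ x
  slideˡ-low {x} x<i rewrite dec-false (i ≤? x) (<⇒≱ x<i) = refl

  slideʳ-high : ∀ {x} → i ≤ x → slideʳ i B x ≡ x
  slideʳ-high {x} i≤x rewrite dec-true (i ≤? x) i≤x = refl

  slideʳ-low : ∀ {x} → x < i → slideʳ i B x ≡ countʳ x
  slideʳ-low {x} x<i rewrite dec-false (i ≤? x) (<⇒≱ x<i) = refl

  -- The two windows together hold distinct values from 1 to `j`. This one bound keeps the truncated
  -- subtraction exact, keeps new values in range, and yields `slide-cross`.
  count-+-count : ∀ a b → countˡ a + countʳ b ≤ j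
  count-+-count a b = subst (_≤ j) (length-++ (filter (inWindowˡ i a) A))
    (pigeonhole 1 i
      (Unique-⊆ window⊆ u)
      (tabulate λ x∈ → lookup (Sub.All-resp-⊆ window⊆ pos) x∈ , bounded x∈))
    where
    window⊆ : filter (inWindowˡ i a) A ++ filter (inWindowʳ i b) B ⊆ A ++ B
    window⊆ = Sub.++⁺ (Sub.filter-⊆ (inWindowˡ i a) A) (Sub.filter-⊆ (inWindowʳ i b) B)
    bounded : ∀ {x} → x ∈ filter (inWindowˡ i a) A ++ filter (inWindowʳ i b) B → x < i
    bounded x∈ with ∈-++⁻ (filter (inWindowˡ i a) A) x∈
    ... | inj₁ p = proj₂ (proj₂ (∈-filter⁻ (inWindowˡ i a) {xs = A} p))
    ... | inj₂ p = proj₂ (proj₂ (∈-filter⁻ (inWindowʳ i b) {xs = B} p))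

  countˡ≤ : ∀ a → countˡ a ≤ j
  -- The 0 is an arbitrary argument; the right-hand count is discarded.
  countˡ≤ a = ≤-trans (m≤m+n _ _) (count-+-count a 0)

  slideˡ-squeeze : Squeeze i A (slideˡ i A)
  slideˡ-squeeze .Squeeze.fixed = slideˡ-high
  slideˡ-squeeze .Squeeze.low {x} x∈ x<i = subst (_< i) (sym (slideˡ-low x<i))
    (∸-monoʳ-< (count-∈ (inWindowˡ i x) x∈ (≤-refl , x<i)) (m≤n⇒m≤1+n (countˡ≤ x)))
  slideˡ-squeeze .Squeeze.positive {x} x∈ x<i = subst (1 ≤_) (sym (slideˡ-low x<i)) (m<n⇒0<n∸m (s≤s (countˡ≤ x)))
  slideˡ-squeeze .Squeeze.mono-low {x} {y} x∈ y∈ x<y y<i =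
    subst₂ _<_ (sym (slideˡ-low (<-trans x<y y<i))) (sym (slideˡ-low y<i))
      (∸-monoʳ-< (count-< (inWindowˡ i y) (inWindowˡ i x) (λ (y≤z , z<i) → ≤-trans (<⇒≤ x<y) y≤z , z<i)
                   x∈ (≤-refl , <-trans x<y y<i) (λ (y≤x , _) → <⇒≱ x<y y≤x))
                 (m≤n⇒m≤1+n (countˡ≤ x)))

  slideʳ-squeeze : Squeeze i B (slideʳ i B)
  slideʳ-squeeze .Squeeze.fixed = slideʳ-high
  slideʳ-squeeze .Squeeze.low {x} x∈ x<i = subst (_< i) (sym (slideʳ-low x<i)) (s≤s (≤-trans (m≤n+m _ _) (count-+-count 0 x)))
  slideʳ-squeeze .Squeeze.positive {x} x∈ x<i = subst (1 ≤_) (sym (slideʳ-low x<i)) (count-∈ (inWindowʳ i x) x∈ (≤-refl , x<i))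
  slideʳ-squeeze .Squeeze.mono-low {x} {y} x∈ y∈ x<y y<i =
    subst₂ _<_ (sym (slideʳ-low (<-trans x<y y<i))) (sym (slideʳ-low y<i))
      (count-< (inWindowʳ i x) (inWindowʳ i y) (λ (z≤x , z<i) → ≤-trans z≤x (<⇒≤ x<y) , z<i)
        y∈ (≤-refl , y<i) (λ (y≤x , _) → <⇒≱ x<y y≤x))

  slide-cross : Cross i A B (slideˡ i A) (slideʳ i B)
  slide-cross {a} {b} _ _ a<i b<i = subst₂ _<_ (sym (slideʳ-low b<i)) (sym (slideˡ-low a<i))
    (m+n≤o⇒m≤o∸n (suc (countʳ b)) (s≤s (subst (_≤ j) (+-comm (countˡ a) (countʳ b)) (count-+-count a b))))

swuAt-step : ∀ {j t} → IsPerm n xs → j < n → t ⊩ xs → Avoids132From (suc (suc j)) xs →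
  IsPerm n (swuAt (suc j) xs) × t ⊩ swuAt (suc j) xs × Avoids132From (suc j) (swuAt (suc j) xs)
swuAt-step {n} {xs} {j} {t} px j<n tx avoid with A , B , refl ← ∈-∃++ (IsPerm⇒∈ px j<n) =
  subst (λ ys → IsPerm n ys × t ⊩ ys × Avoids132From i ys) (sym (swuAt-++ i A i∉A))
    ( toIsPerm (Unique-slide A sf sg cross u) (++⁺ (InRange-squeeze j<n sf (++⁻ˡ A rng)) (InRange-squeeze j<n sg (++⁻ʳ A rng))) len
    , ⊩-slide A B refl sf sg tx
    , Avoids132From-slide A u sf sg cross avoid)
  where
  i : ℕ
  i = suc j
  u : Unique (A ++ i ∷ B)
  u = IsPerm⇒Unique px
  i∉A : i ∉ A
  i∉A i∈ = Unique-++-≢ A u i∈ (here refl) refl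
  rng : All (InRange n) (A ++ i ∷ B)
  rng = IsPerm⇒InRange px
  f g : ℕ → ℕ
  f = slideˡ i A
  g = slideʳ i (i ∷ B)
  sf : Squeeze i A f
  sf = slideˡ-squeeze A (i ∷ B) u (All-map proj₁ rng)
  sg : Squeeze i (i ∷ B) g
  sg = slideʳ-squeeze A (i ∷ B) u (All-map proj₁ rng)
  cross : Cross i A (i ∷ B) f g
  cross = slide-cross A (i ∷ B) u (All-map proj₁ rng)
  len : length (map f A ++ map g (i ∷ B)) ≡ n
  len = trans (length-++ (map f A)) (trans (cong₂ _+_ (length-map f A) (length-map g (i ∷ B)))
          (trans (sym (length-++ A)) (IsPerm⇒length px)))

-- The slides run from the largest index down to 1, and each lowers the threshold of avoidance by
-- one.
swu-step : ∀ {t} m → m ≤ n → IsPerm n xs → t ⊩ xs → Avoids132From (suc m) xs →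
  IsPerm n (swu m xs) × t ⊩ swu m xs × Avoids132From 1 (swu m xs)
swu-step zero    _   px tx avoid = px , tx , avoid
swu-step (suc m) m<n px tx avoid with px′ , tx′ , avoid′ ← swuAt-step px m<n tx avoid =
  swu-step m (<⇒≤ m<n) px′ tx′ avoid′

swu-⊩ : ∀ {t} → IsPerm n xs → t ⊩ xs → IsPerm n (swu n xs) × t ⊩ swu n xs × Avoids132From 1 (swu n xs)
swu-⊩ {n} px tx = swu-step n ≤-refl px tx
  -- The initial threshold is `suc n`, above every entry, so the condition is vacuous.
  λ p n<v → ⊥-elim (<⇒≱ (proj₂ (lookup (IsPerm⇒InRange px) (⊆⇒∈ p (there (here refl))))) n<v)

-- Between consecutive slides the two reversals cancel, leaving only the outermost ones.
swd≡reverse-swu : ∀ m xs → swd m xs ≡ reverse (swu m (reverse xs))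
swd≡reverse-swu zero    xs = sym (reverse-involutive xs)
swd≡reverse-swu (suc m) xs = trans (swd≡reverse-swu m (swdAt (suc m) xs))
  (cong (reverse ∘ swu m) (reverse-involutive (swuAt (suc m) (reverse xs))))

-- The 132-avoiding labelling of a shape

-- `o` is the least label. Avoiding 132 puts the whole right subtree below the whole left subtree,
-- so labels are handed out in the order right, left, root.
labels132 : ℕ → Shape → List ℕ
labels132 o leaf       = []
labels132 o (node l r) = labels132 (o + size r) l ++ (o + size r + size l) ∷ labels132 o r

-- Avoidance with the root as "3" gives `R<L`. Counting distinct values below or above an entry then
-- confines `R`, `L` and `m` to consecutive intervals, and the subtrees follow by recursion.
≡labels132 : ∀ {t} o → t ⊩ xs → Unique xs → All (λ x → o ≤ x × x < o + size t) xs →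
  Avoids132From 1 xs → xs ≡ labels132 o t
≡labels132 o leaf _ _ _ = refl
≡labels132 o (node {l} {r} {L} {m} {R} tl tr pl pr) u rng avoid =
  cong₂ _++_
    (≡labels132 (o + size r) tl uL (tabulate λ x∈ → L-lower x∈ , <-≤-trans (lookup pl x∈) (≤-reflexive m≡)) (avoid ∘ (λ p → ⊆-trans p L⊆)))
    (cong₂ _∷_ m≡
      (≡labels132 o tr uR (tabulate λ x∈ → proj₁ (lookup rngR x∈) , R-upper x∈) (avoid ∘ (λ p → ⊆-trans p R⊆))))
  where
  L⊆ : L ⊆ L ++ m ∷ R
  L⊆ = Sub.++⁺ʳ (m ∷ R) ⊆-refl
  R⊆ : R ⊆ L ++ m ∷ R
  R⊆ = Sub.++⁺ˡ L (m ∷ʳ ⊆-refl)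
  LR⊆ : L ++ R ⊆ L ++ m ∷ R
  LR⊆ = Sub.++⁺ (⊆-refl {x = L}) (m ∷ʳ ⊆-refl)
  Lm⊆ : L ++ [ m ] ⊆ L ++ m ∷ R
  Lm⊆ = Sub.++⁺ (⊆-refl {x = L}) (refl ∷ minimum R)
  uL : Unique L
  uL = Unique-⊆ L⊆ u
  uR : Unique R
  uR = Unique-⊆ R⊆ u
  rngR : All (λ x → o ≤ x × x < o + suc (size l + size r)) R
  rngR = Sub.All-resp-⊆ R⊆ rng
  rngm : o ≤ m × m < o + suc (size l + size r)
  rngm = lookup rng (∈-insert L)
  R<L : ∀ {a b} → a ∈ L → b ∈ R → b < a
  R<L {a} a∈ b∈ = avoid (Sub.++⁺ (from∈ a∈) (refl ∷ from∈ b∈)) (≤-trans (s≤s z≤n) (lookup pl a∈)) (lookup pl a∈) (lookup pr b∈)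
  L-lower : ∀ {a} → a ∈ L → o + size r ≤ a
  L-lower {a} a∈ = subst (_≤ a) (trans (+-comm _ o) (cong (o +_) (⊩-length tr)))
    -- All of `R` fits between `o` and `a`, which forces `a` up by `size r`.
    (m≤o∸n⇒m+n≤o (length R) (proj₁ (lookup (Sub.All-resp-⊆ L⊆ rng) a∈))
      (pigeonhole o a uR (tabulate λ b∈ → proj₁ (lookup rngR b∈) , R<L a∈ b∈)))
  R-upper : ∀ {b} → b ∈ R → b < o + size r
  R-upper {b} b∈ = +-cancelˡ-≤ (suc (size l)) _ _ (subst₂ _≤_ lhs rhs
    -- The `size l + 1` entries of `L ++ [ m ]` all lie above `b` and below the end of the range,
    -- which forces `b` down.
    (m≤o∸n⇒m+n≤o (length (L ++ [ m ])) (proj₂ (lookup rngR b∈))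
      (pigeonhole (suc b) (o + suc (size l + size r)) (Unique-⊆ Lm⊆ u)
        (tabulate λ a∈ → above a∈ , proj₂ (lookup (Sub.All-resp-⊆ Lm⊆ rng) a∈)))))
    where
    above : ∀ {a} → a ∈ L ++ [ m ] → b < a
    above a∈ with ∈-++⁻ L a∈
    ... | inj₁ p           = R<L p b∈
    ... | inj₂ (here refl) = lookup pr b∈
    lhs : length (L ++ [ m ]) + suc b ≡ suc (size l) + suc b
    lhs = cong (_+ suc b) (trans (length-++ L) (trans (+-comm _ 1) (cong suc (⊩-length tl))))
    rhs : o + suc (size l + size r) ≡ suc (size l) + (o + size r)
    rhs = trans (sym (+-assoc o (suc (size l)) (size r))) (trans (cong (_+ size r) (+-comm o (suc (size l)))) (+-assoc (suc (size l)) o (size r)))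
  total : o + size r + size l ≡ o + (size l + size r)
  total = trans (+-assoc o _ _) (cong (o +_) (+-comm (size r) (size l)))
  m≡ : m ≡ o + size r + size l
  -- The range bounds `m` from above; from below, all the other entries fit between `o` and `m`.
  m≡ = ≤-antisym
    (≤-trans (≤-pred (subst (m <_) (+-suc o _) (proj₂ rngm))) (≤-reflexive (sym total)))
    (subst (_≤ m) (trans (+-comm _ o) (trans (cong (o +_) (trans (length-++ L) (cong₂ _+_ (⊩-length tl) (⊩-length tr)))) (sym total)))
      (m≤o∸n⇒m+n≤o (length (L ++ R)) (proj₁ rngm)
        (pigeonhole o m (Unique-⊆ LR⊆ u)
          (tabulate λ x∈ → proj₁ (lookup (Sub.All-resp-⊆ LR⊆ rng) x∈) , lookup (++⁺ pl pr) x∈))))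

⊩-Avoids132-unique : ∀ {t} → IsPerm n xs → IsPerm n ys → t ⊩ xs → t ⊩ ys →
  Avoids132From 1 xs → Avoids132From 1 ys → xs ≡ ys
⊩-Avoids132-unique {n} {t = t} px py tx ty ax ay = trans (eq px tx ax) (sym (eq py ty ay))
  where
  eq : ∀ {zs} → IsPerm n zs → t ⊩ zs → Avoids132From 1 zs → zs ≡ labels132 1 t
  eq pz tz = ≡labels132 1 tz (IsPerm⇒Unique pz)
    (subst (λ k → All (InRange k) _) (trans (sym (IsPerm⇒length pz)) (⊩-length tz)) (IsPerm⇒InRange pz))

-- Containment of 132 and 231

lt⇔lt : ∀ {x a y b} → x < a → y < b → ((x < a) ⇔ (y < b)) × ((a < x) ⇔ (b < y))
lt⇔lt x<a y<b = mk⇔ (λ _ → y<b) (λ _ → x<a) , mk⇔ (⊥-elim ∘ <-asym x<a) (⊥-elim ∘ <-asym y<b)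

gt⇔gt : ∀ {x a y b} → a < x → b < y → ((x < a) ⇔ (y < b)) × ((a < x) ⇔ (b < y))
gt⇔gt a<x b<y = mk⇔ (⊥-elim ∘ <-asym a<x) (⊥-elim ∘ <-asym b<y) , mk⇔ (λ _ → b<y) (λ _ → a<x)

OrderIso-132 : ∀ {a v b} → a < b → b < v → OrderIso (a ∷ v ∷ b ∷ []) p132
OrderIso-132 a<b b<v =
  (lt⇔lt (<-trans a<b b<v) (s≤s (s≤s z≤n)) ∷ lt⇔lt a<b (s≤s (s≤s z≤n)) ∷ []) , (gt⇔gt b<v (s≤s (s≤s (s≤s z≤n))) ∷ []) , [] , tt

OrderIso-231 : ∀ {a v b} → b < a → a < v → OrderIso (a ∷ v ∷ b ∷ []) p231
OrderIso-231 b<a a<v =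
  (lt⇔lt a<v (s≤s (s≤s (s≤s z≤n))) ∷ gt⇔gt b<a (s≤s (s≤s z≤n)) ∷ []) , (gt⇔gt (<-trans b<a a<v) (s≤s (s≤s z≤n)) ∷ []) , [] , tt

Avoids132From⁺ : ∀ {k} → Unique xs → (∀ {a v b} → a ∷ v ∷ b ∷ [] ⊆ xs → a < b → b < v → ⊥) → Avoids132From k xs
Avoids132From⁺ u avoid {a} {v} {b} p _ a<v b<v with <-cmp a b
... | tri> _ _ b<a = b<a
... | tri< a<b _ _ = ⊥-elim (avoid p a<b b<v)
... | tri≈ _ refl _ with (_ ∷ a≢a ∷ []) ∷ _ ← Unique-⊆ p u = ⊥-elim (a≢a refl)

Avoids-132⁻ : Unique xs → Avoids xs p132 → Avoids132From 1 xs
Avoids-132⁻ u avoid = Avoids132From⁺ u λ p a<b b<v → avoid (_ , p , OrderIso-132 a<b b<v)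

Avoids-132⁺ : Avoids132From 1 xs → Avoids xs p132
Avoids-132⁺ avoid (a ∷ v ∷ b ∷ [] , p , ((a~v ∷ a~b ∷ []) , (v~b ∷ []) , _)) =
  <-asym a<b (avoid p (≤-trans (s≤s z≤n) a<v) a<v (Equivalence.from (proj₂ v~b) (s≤s (s≤s (s≤s z≤n)))))
  where
  a<v : a < v
  a<v = Equivalence.from (proj₁ a~v) (s≤s (s≤s z≤n))
  a<b : a < b
  a<b = Equivalence.from (proj₁ a~b) (s≤s (s≤s z≤n))

-- The reversal of 231 is 132, so only one notion of avoidance has to be followed through the
-- slides.
Avoids-231⁻ : Unique xs → Avoids xs p231 → Avoids132From 1 (reverse xs)
Avoids-231⁻ {xs} u avoid = Avoids132From⁺ (Unique-resp-↭ (↭-sym (Perm.↭-reverse xs)) u) λ p a<b b<v →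
  avoid (_ , subst (_ ⊆_) (reverse-involutive xs) (Sub.reverse⁺ p) , OrderIso-231 a<b b<v)

Avoids-231⁺ : Avoids132From 1 (reverse xs) → Avoids xs p231
Avoids-231⁺ avoid (a ∷ v ∷ b ∷ [] , p , ((a~v ∷ a~b ∷ []) , (v~b ∷ []) , _)) =
  <-asym b<a (avoid (Sub.reverse⁺ p) (≤-trans (s≤s z≤n) a<v) (<-trans b<a a<v) a<v)
  where
  a<v : a < v
  a<v = Equivalence.from (proj₁ a~v) (s≤s (s≤s (s≤s z≤n)))
  b<a : b < a
  b<a = Equivalence.from (proj₂ a~b) (s≤s (s≤s z≤n))

-- The two maps on the avoidance classes

IsPerm-reverse : IsPerm n xs → IsPerm n (reverse xs)
IsPerm-reverse {xs = xs} px = ↭-trans (Perm.↭-reverse xs) px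

-- Conjugating `swu-⊩` by reversal mirrors the shape twice, so the shape itself is restored.
swd-⊩ : ∀ {t} → IsPerm n xs → t ⊩ xs → IsPerm n (swd n xs) × t ⊩ swd n xs × Avoids132From 1 (reverse (swd n xs))
swd-⊩ {n} {xs} {t} px tx with py , ty , ay ← swu-⊩ (IsPerm-reverse px) (⊩-reverse tx) =
  subst (λ zs → IsPerm n zs × t ⊩ zs × Avoids132From 1 (reverse zs)) (sym (swd≡reverse-swu n xs))
    ( IsPerm-reverse py
    , subst (_⊩ _) (mirror-involutive t) (⊩-reverse ty)
    , subst (Avoids132From 1) (sym (reverse-involutive _)) ay)

swu-U : U n p231 xs → U n p132 (swu n xs)
swu-U (px , ux , _) with _ , tx ← Unique⇒⊩ (IsPerm⇒Unique px) with py , ty , ay ← swu-⊩ px tx =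
  py , UniquelySorted-⊩ px py tx ty ux , Avoids-132⁺ ay

swd-U : U n p132 xs → U n p231 (swd n xs)
swd-U (px , ux , _) with _ , tx ← Unique⇒⊩ (IsPerm⇒Unique px) with py , ty , ay ← swd-⊩ px tx =
  py , UniquelySorted-⊩ px py tx ty ux , Avoids-231⁺ ay

-- The composite keeps the shape and ends in a 231-avoiding word, as is `xs`. After reversal both
-- are 132-avoiding of the mirrored shape, hence equal.
swd-swu : IsPerm n xs → Avoids xs p231 → swd n (swu n xs) ≡ xs
swd-swu px ax with _ , tx ← Unique⇒⊩ (IsPerm⇒Unique px) with py , ty , _ ← swu-⊩ px tx with pz , tz , az ← swd-⊩ py ty =
  reverse-injective (⊩-Avoids132-unique (IsPerm-reverse pz) (IsPerm-reverse px) (⊩-reverse tz) (⊩-reverse tx)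
    az (Avoids-231⁻ (IsPerm⇒Unique px) ax))

swu-swd : IsPerm n xs → Avoids xs p132 → swu n (swd n xs) ≡ xs
swu-swd px ax with _ , tx ← Unique⇒⊩ (IsPerm⇒Unique px) with py , ty , _ ← swd-⊩ px tx with pz , tz , az ← swu-⊩ py ty =
  ⊩-Avoids132-unique pz px tz tx az (Avoids-132⁻ (IsPerm⇒Unique px) ax)

-- Bijectivity is expressed by the last two components, the inverse laws on the two classes.
theorem6p1 : (k : ℕ) →
    ((π : List ℕ) → U (suc (2 * k)) p231 π → U (suc (2 * k)) p132 (swu (suc (2 * k)) π))
    × ((π : List ℕ) → U (suc (2 * k)) p132 π → U (suc (2 * k)) p231 (swd (suc (2 * k)) π))
    × ((π : List ℕ) → U (suc (2 * k)) p231 π → swd (suc (2 * k)) (swu (suc (2 * k)) π) ≡ π)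
    × ((π : List ℕ) → U (suc (2 * k)) p132 π → swu (suc (2 * k)) (swd (suc (2 * k)) π) ≡ π)
theorem6p1 k = (λ _ → swu-U) , (λ _ → swd-U) , (λ _ (px , _ , ax) → swd-swu px ax) , (λ _ (px , _ , ax) → swu-swd px ax)
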